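{- If $G$ is a graph with $\operatorname{box}(G)=b$, then $G$ contains a simple cycle of length at least $b-3$.
   Context: The boxicity $\operatorname{box}(G)$ is the minimum $b$ such that $G$ is the intersection graph of axis-parallel boxes in $\mathbb{R}^b$ (products of $b$ closed intervals), one box per vertex.
   Formalization: The formal theorem assumes b ≥ 3; for b ≤ 2 the bound b−3 is negative and the claim that a cycle exists fails (a single vertex has boxicity 0, a 3-vertex path 1, a subdivided claw 2, and none contains a cycle). -}

module Defs where

open import Level using (0ℓ)
open import Data.Nat as ℕ using (ℕ; suc; _≤_)
open import Data.Fin using (Fin; zero; suc; inject₁; fromℕ)
open import Data.Rational as ℚ using (ℚ)
open import Data.Product using (Σ; ∃; ∃-syntax; _×_)
open import Data.Sum using (_⊎_)
open import Function.Bundles using (_⇔_)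
open import Function.Definitions using (Injective)
open import Relation.Binary.Core using (Rel)
open import Relation.Binary.Definitions using (Symmetric; Irreflexive; Decidable)
open import Relation.Binary.PropositionalEquality using (_≡_; _≢_)
open import Relation.Nullary using (¬_)

-- Two-sided Dedekind cuts of ℚ.
record ℝ : Set₁ where
  field
    Lower Upper : ℚ → Set
    lower-inhabited : ∃ Lower
    upper-inhabited : ∃ Upper
    lower-rounded   : ∀ q → Lower q ⇔ (∃[ r ] q ℚ.< r × Lower r)
    upper-rounded   : ∀ r → Upper r ⇔ (∃[ q ] q ℚ.< r × Upper q)
    disjoint        : ∀ q → ¬ (Lower q × Upper q)
    located         : ∀ q r → q ℚ.< r → Lower q ⊎ Upper r

infix 4 _≤ℝ_

_≤ℝ_ : ℝ → ℝ → Set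
x ≤ℝ y = ∀ q → ℝ.Lower x q → ℝ.Lower y q

record ClosedInterval : Set₁ where
  field
    left right : ℝ
    left≤right : left ≤ℝ right

infix 4 _∈ᴵ_ _∈ᴮ_

_∈ᴵ_ : ℝ → ClosedInterval → Set
x ∈ᴵ I = ClosedInterval.left I ≤ℝ x × x ≤ℝ ClosedInterval.right I

Point : ℕ → Set₁
Point b = Fin b → ℝ

Box : ℕ → Set₁
Box b = Fin b → ClosedInterval

_∈ᴮ_ : ∀ {b} → Point b → Box b → Set
p ∈ᴮ B = ∀ i → p i ∈ᴵ B i

Intersect : ∀ {b} → Box b → Box b → Set₁
Intersect {b} B C = Σ (Point b) λ p → p ∈ᴮ B × p ∈ᴮ C

record Graph (n : ℕ) : Set₁ where
  field
    Adj    : Rel (Fin n) 0ℓ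
    adj?   : Decidable Adj
    sym    : Symmetric Adj
    irrefl : Irreflexive _≡_ Adj

module _ {n : ℕ} (G : Graph n) where
  open Graph G

  -- For b = 0 all boxes are the one-point space, so exactly the complete
  -- graphs are represented.
  BoxRepresentation : ℕ → Set₁
  BoxRepresentation b =
    Σ (Fin n → Box b) λ box →
      ∀ u v → u ≢ v → Adj u v ⇔ Intersect (box u) (box v)

  IsBoxicity : ℕ → Set₁
  IsBoxicity b = BoxRepresentation b × (∀ b′ → BoxRepresentation b′ → b ≤ b′)

  record SimpleCycle : Set where
    field
      pred-length : ℕ
    length : ℕ
    length = suc pred-length
    field
      3≤length    : 3 ≤ length
      vertex      : Fin length → Fin n
      distinct    : Injective _≡_ _≡_ vertex
      consecutive : ∀ i → Adj (vertex (inject₁ i)) (vertex (suc i))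
      closing     : Adj (vertex (fromℕ pred-length)) (vertex zero)

{-# OPTIONS --safe #-}

-- A depth-first search forest of G has only edges between an ancestor and a
-- descendant, and an edge spanning j levels closes a cycle of length j + 1
-- with the tree path.  So if every cycle is shorter than c + 1, every edge
-- spans fewer than c levels, and G has a box representation of dimension
-- 1 + c: the search intervals separate incomparable vertices, and for each
-- residue i modulo c one further coordinate separates every vertex at a level
-- congruent to i from its non-adjacent descendants.  If G has no cycle at all,
-- the search intervals and the levels already give dimension 2.
module Submission where

open import Data.Nat using (ℕ; _≤_; _∸_)
open import Data.Product using (Σ)
open import Defs

open import Data.Fin using (Fin; zero; suc; inject₁; fromℕ; toℕ)
open import Data.Fin.Properties using (_≟_; any?; toℕ-injective; toℕ-fromℕ<)
import Data.Integer as ℤ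
import Data.Integer.Properties as ℤ
open import Data.List using (List; []; _∷_; _++_; length; filter; allFin)
open import Data.List.Membership.Propositional using (_∈_; find)
open import Data.List.Membership.Propositional.Properties using (∈-++⁺ˡ; ∈-++⁺ʳ; ∈-filter⁺; ∈-filter⁻; ∈-allFin)
open import Data.List.Properties using (filter-notAll)
open import Data.List.Relation.Unary.All as All using (All; []; _∷_)
import Data.List.Relation.Unary.All.Properties as All
open import Data.List.Relation.Unary.AllPairs using (AllPairs; []; _∷_)
import Data.List.Relation.Unary.AllPairs.Properties as AllPairs
open import Data.List.Relation.Unary.Any as Any using (here; there)
open import Data.Nat using (zero; suc; _+_; _*_; _<_; _⊔_; _/_; _%_; _≤?_; _<?_; z≤n; s≤s; s≤s⁻¹; NonZero)
open import Data.Nat.DivMod using (_mod_; m≡m%n+[m/n]*n)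
open import Data.Nat.Properties hiding (_≟_)
open import Algebra.Properties.CommutativeSemigroup +-commutativeSemigroup using (x∙yz≈y∙xz)
open import Data.Product using (∃; ∃-syntax; _×_; _,_; proj₁; proj₂)
open import Data.Rational as ℚ using (ℚ; *≤*; *<*)
open import Data.Rational.Literals using (fromℤ)
import Data.Rational.Properties as ℚ
open import Data.Sum as Sum using (_⊎_; inj₁; inj₂)
open import Function using (_∘_)
open import Function.Bundles using (mk⇔)
open import Relation.Binary.PropositionalEquality using (_≡_; _≢_; refl; sym; trans; cong; cong₂; subst; ≢-sym)
open import Relation.Nullary using (¬_; Dec; yes; no; ¬?; contradiction)
open import Relation.Nullary.Decidable using (_×-dec_; decidable-stable)
open import Relation.Unary using (Pred; Decidable; U)
open import Relation.Unary.Properties using (U?)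
open import Level using (0ℓ)

-- Arithmetic of residues

-- With equal remainders, `m < n` forces a strictly larger quotient, and one more quotient costs at
-- least `c`.
%-distance : ∀ {m n c} .{{_ : NonZero c}} → m % c ≡ n % c → m < n → c + m ≤ n
%-distance {m} {n} {c} eq m<n = begin
  c + m                         ≡⟨ cong (c +_) (m≡m%n+[m/n]*n m c) ⟩
  c + (m % c + m / c * c)       ≡⟨ cong (λ r → c + (r + m / c * c)) eq ⟩
  c + (n % c + m / c * c)       ≡⟨ x∙yz≈y∙xz c (n % c) (m / c * c) ⟩
  n % c + suc (m / c) * c       ≤⟨ +-monoʳ-≤ (n % c) (*-monoˡ-≤ c quotient<) ⟩
  n % c + n / c * c             ≡⟨ m≡m%n+[m/n]*n n c ⟨
  n                             ∎
  where
  open ≤-Reasoning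
  quotient< : m / c < n / c
  quotient< = ≰⇒> λ n/c≤m/c → <⇒≱ m<n (begin
    n                  ≡⟨ m≡m%n+[m/n]*n n c ⟩
    n % c + n / c * c  ≤⟨ +-mono-≤ (≤-reflexive (sym eq)) (*-monoˡ-≤ c n/c≤m/c) ⟩
    m % c + m / c * c  ≡⟨ m≡m%n+[m/n]*n m c ⟨
    m                  ∎)

-- Boxes with natural end points

ℕ→ℚ : ℕ → ℚ
ℕ→ℚ m = fromℤ (ℤ.+ m)

ℕ→ℚ-mono-≤ : ∀ {m n} → m ≤ n → ℕ→ℚ m ℚ.≤ ℕ→ℚ n
ℕ→ℚ-mono-≤ m≤n = *≤* (ℤ.*-monoʳ-≤-nonNeg (ℤ.+ 1) (ℤ.+≤+ m≤n))

ℕ→ℚ-mono-< : ∀ {m n} → m < n → ℕ→ℚ m ℚ.< ℕ→ℚ n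
ℕ→ℚ-mono-< m<n = *<* (ℤ.*-monoʳ-<-pos (ℤ.+ 1) (ℤ.+<+ m<n))

ℚ→ℝ : ℚ → ℝ
ℚ→ℝ p = record
  { Lower           = ℚ._< p
  ; Upper           = p ℚ.<_
  ; lower-inhabited = p ℚ.- ℚ.1ℚ , subst (p ℚ.- ℚ.1ℚ ℚ.<_) (ℚ.+-identityʳ p) (ℚ.+-monoʳ-< p (ℚ.negative⁻¹ (ℚ.- ℚ.1ℚ)))
  ; upper-inhabited = p ℚ.+ ℚ.1ℚ , subst (ℚ._< p ℚ.+ ℚ.1ℚ) (ℚ.+-identityʳ p) (ℚ.+-monoʳ-< p (ℚ.positive⁻¹ ℚ.1ℚ))
  ; lower-rounded   = λ q → mk⇔ ℚ.<-dense (λ (r , q<r , r<p) → ℚ.<-trans q<r r<p)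
  ; upper-rounded   = λ r → mk⇔ (λ p<r → let q , p<q , q<r = ℚ.<-dense p<r in q , q<r , p<q)
                                (λ (q , q<r , p<q) → ℚ.<-trans p<q q<r)
  ; disjoint        = λ q (q<p , p<q) → ℚ.<-asym q<p p<q
  ; located         = located
  }
  where
  located : ∀ q r → q ℚ.< r → q ℚ.< p ⊎ p ℚ.< r
  located q r q<r with q ℚ.<? p
  ... | yes q<p = inj₁ q<p
  ... | no  q≮p = inj₂ (ℚ.≤-<-trans (ℚ.≮⇒≥ q≮p) q<r)

ℕ→ℝ : ℕ → ℝ
ℕ→ℝ m = ℚ→ℝ (ℕ→ℚ m)

ℕ→ℝ-mono : ∀ {m n} → m ≤ n → ℕ→ℝ m ≤ℝ ℕ→ℝ n
ℕ→ℝ-mono m≤n q q<m = ℚ.<-≤-trans q<m (ℕ→ℚ-mono-≤ m≤n)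

ℕ→ℝ-cancel : ∀ {m n} → ℕ→ℝ m ≤ℝ ℕ→ℝ n → m ≤ n
ℕ→ℝ-cancel {m} {n} m≤n with m ≤? n
... | yes p = p
-- If `n < m`, the rational `n` lies in the lower cut of `m`, hence in its own.
... | no ¬p = contradiction (m≤n (ℕ→ℚ n) (ℕ→ℚ-mono-< (≰⇒> ¬p))) (ℚ.<-irrefl refl)

-- Turns the real geometry into inequalities between naturals. One inequality per edge is enough,
-- since the reversed edge supplies the other.
box-representation : ∀ {n b} (G : Graph n) → let open Graph G in
  (lo hi : Fin b → Fin n → ℕ) →
  (∀ i v → lo i v ≤ hi i v) →
  (∀ i {u v} → Adj u v → lo i u ≤ hi i v) →
  (∀ {u v} → u ≢ v → ¬ Adj u v → ∃[ i ] (hi i u < lo i v ⊎ hi i v < lo i u)) →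
  BoxRepresentation G b
box-representation {n} {b} G lo hi lo≤hi adjacent non-adjacent = box , λ u v u≢v → mk⇔ (meet u v) (reflect u≢v)
  where
  open Graph G using (Adj; adj?) renaming (sym to Adj-sym)

  box : Fin n → Box b
  box v i = record { left = ℕ→ℝ (lo i v) ; right = ℕ→ℝ (hi i v) ; left≤right = ℕ→ℝ-mono (lo≤hi i v) }

  meet : ∀ u v → Adj u v → Intersect (box u) (box v)
  meet u v uv =
    -- In each coordinate the larger left end point lies in both intervals.
    (λ i → ℕ→ℝ (lo i u ⊔ lo i v)) ,
    (λ i → ℕ→ℝ-mono (m≤m⊔n _ _) , ℕ→ℝ-mono (⊔-lub (lo≤hi i u) (adjacent i (Adj-sym uv)))) ,
    (λ i → ℕ→ℝ-mono (m≤n⊔m (lo i u) _) , ℕ→ℝ-mono (⊔-lub (adjacent i uv) (lo≤hi i v)))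

  reflect : ∀ {u v} → u ≢ v → Intersect (box u) (box v) → Adj u v
  reflect {u} {v} u≢v (p , p∈u , p∈v) = decidable-stable (adj? u v) λ ¬uv → disjoint (non-adjacent u≢v ¬uv)
    where
    disjoint : ¬ (∃[ i ] (hi i u < lo i v ⊎ hi i v < lo i u))
    disjoint (i , inj₁ u<v) = <⇒≱ u<v (ℕ→ℝ-cancel (λ q → proj₂ (p∈u i) q ∘ proj₁ (p∈v i) q))
    disjoint (i , inj₂ v<u) = <⇒≱ v<u (ℕ→ℝ-cancel (λ q → proj₂ (p∈v i) q ∘ proj₁ (p∈u i) q))

-- Depth-first search

AllPairs-lookup : ∀ {A : Set} {R : A → A → Set} {xs x y} → AllPairs R xs →
  x ∈ xs → y ∈ xs → x ≡ y ⊎ (R x y ⊎ R y x)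
AllPairs-lookup (_  ∷ _)  (here refl) (here refl) = inj₁ refl
AllPairs-lookup (rs ∷ _)  (here refl) (there y∈)  = inj₂ (inj₁ (All.lookup rs y∈))
AllPairs-lookup (rs ∷ _)  (there x∈)  (here refl) = inj₂ (inj₂ (All.lookup rs x∈))
AllPairs-lookup (_  ∷ ps) (there x∈)  (there y∈)  = AllPairs-lookup ps x∈ y∈

module _ {n} (G : Graph n) where
  open Graph G using (Adj; adj?; irrefl) renaming (sym to Adj-sym)

  record Visit : Set where
    constructor visit
    field
      vertex            : Fin n
      enter leave level : ℕ

  open Visit

  -- Ancestry read off from nested search intervals. The strict growth of level is carried along for
  -- the later comparisons of depth.
  Encloses : Visit → Visit → Set
  Encloses e f = enter e < enter f × leave f ≤ leave e × level e < level f

  encloses? : ∀ e f → Dec (Encloses e f)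
  encloses? e f = enter e <? enter f ×-dec leave f ≤? leave e ×-dec level e <? level f

  -- The non-adjacency clause says that depth-first search leaves no cross edges.
  Precedes : Visit → Visit → Set
  Precedes e f = leave e < enter f × ¬ Adj (vertex e) (vertex f)

  record InPreorder (e f : Visit) : Set where
    constructor in-preorder
    field
      distinct : vertex e ≢ vertex f
      position : Encloses e f ⊎ Precedes e f

  ChildOf : Visit → Visit → Set
  ChildOf e p = Adj (vertex p) (vertex e) × Encloses p e × level e ≡ suc (level p)

  record Within (start finish base : ℕ) (e : Visit) : Set where
    constructor within
    field
      start≤enter  : start ≤ enter e
      enter≤leave  : enter e ≤ leave e
      leave<finish : leave e < finish
      base≤level   : base ≤ level e

  -- The outcome of searching the unvisited vertices `white` at time `start`
  -- from all roots satisfying `Root`, the roots being placed at level `base`.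
  record Search (white : List (Fin n)) (Root : Pred (Fin n) 0ℓ) (start base : ℕ) : Set where
    field
      visits       : List Visit
      rest         : List (Fin n)
      finish       : ℕ
      start≤finish : start ≤ finish
      rest-length  : length rest ≤ length white
      rest⊆white   : ∀ {w} → w ∈ rest → w ∈ white
      covers       : ∀ {w} → w ∈ white → w ∈ rest ⊎ ∃[ e ] e ∈ visits × vertex e ≡ w
      visited      : All (λ e → vertex e ∈ white) visits
      timely       : All (Within start finish base) visits
      preorder     : AllPairs InPreorder visits
      exhausted    : All (λ e → All (λ w → vertex e ≢ w × ¬ Adj (vertex e) w) rest) visits
      no-root-left : All (λ w → ¬ Root w) rest
      parent       : All (λ e → (Root (vertex e) × level e ≡ base) ⊎ ∃[ p ] p ∈ visits × ChildOf e p) visits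

  -- The first recursive call grows the subtree below a root `r`, with the neighbours of `r` as its
  -- roots; the second resumes with the original roots on what is left. That remainder is an output
  -- of the first call, so the recursion runs on `fuel`, a bound for the length of `white`.
  search : ∀ fuel white → length white ≤ fuel → {Root : Pred (Fin n) 0ℓ} → Decidable Root →
    ∀ start base → Search white Root start base
  search fuel white white≤fuel Root? start base with Any.any? Root? white
  ... | no ¬root = record
    { visits       = []
    ; rest         = white
    ; finish       = start
    ; start≤finish = ≤-refl
    ; rest-length  = ≤-refl
    ; rest⊆white   = λ w∈white → w∈white
    ; covers       = inj₁
    ; visited      = []
    ; timely       = []
    ; preorder     = []
    ; exhausted    = []
    ; no-root-left = All.¬Any⇒All¬ white ¬root
    ; parent       = []
    }
  search zero [] z≤n Root? start base | yes ()
  search (suc fuel) white white≤fuel {Root} Root? start base | yes root = record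
    { visits       = e ∷ S₁.visits ++ S₂.visits
    ; rest         = S₂.rest
    ; finish       = S₂.finish
    ; start≤finish = ≤-trans (<⇒≤ start<mid) S₂.start≤finish
    ; rest-length  = ≤-trans S₂.rest-length (≤-trans S₁.rest-length (<⇒≤ unseen<white))
    ; rest⊆white   = unseen⊆white ∘ S₁.rest⊆white ∘ S₂.rest⊆white
    ; covers       = covers
    ; visited      = r∈white ∷ All.++⁺ (All.map unseen⊆white S₁.visited)
                                       (All.map (unseen⊆white ∘ S₁.rest⊆white) S₂.visited)
    ; timely       = within ≤-refl (<⇒≤ S₁.start≤finish) S₂.start≤finish ≤-refl
                     ∷ All.++⁺ (All.map early S₁.timely) (All.map late S₂.timely)
    ; preorder     = All.++⁺ (All.zipWith root-first (S₁.visited , S₁.timely))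
                             (All.zipWith root-done (S₂.visited , S₂.timely))
                     -- The second search only meets vertices left over by the first, and
                     -- `exhausted` makes these non-adjacent to everything visited there.
                     ∷ AllPairs.++⁺ S₁.preorder S₂.preorder
                         (All.zipWith (λ (ex , tm) → All.zipWith (in-order ex tm) (S₂.visited , S₂.timely))
                                      (S₁.exhausted , S₁.timely))
    -- For `r` itself this is `no-root-left` of the inner search, whose roots are the neighbours of
    -- `r`.
    ; exhausted    = All.tabulate (λ w∈rest → let w∈rest₁ = S₂.rest⊆white w∈rest in
                                     ≢-sym (unseen≢r (S₁.rest⊆white w∈rest₁)) , All.lookup S₁.no-root-left w∈rest₁)
                     ∷ All.++⁺ (All.map (λ ex → All.tabulate (All.lookup ex ∘ S₂.rest⊆white)) S₁.exhausted) S₂.exhausted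
    ; no-root-left = S₂.no-root-left
    ; parent       = inj₁ (r-root , refl)
                     ∷ All.++⁺ (All.zipWith parent₁ (S₁.timely , S₁.parent))
                               (All.map (Sum.map₂ λ (p , p∈ , child) → p , there (∈-++⁺ʳ S₁.visits p∈) , child) S₂.parent)
    }
    where
    r = proj₁ (find root)
    r∈white = proj₁ (proj₂ (find root))
    r-root = proj₂ (proj₂ (find root))

    unseen : List (Fin n)
    unseen = filter (λ w → ¬? (w ≟ r)) white

    unseen⊆white : ∀ {w} → w ∈ unseen → w ∈ white
    unseen⊆white = proj₁ ∘ ∈-filter⁻ (λ w → ¬? (w ≟ r))

    unseen≢r : ∀ {w} → w ∈ unseen → w ≢ r
    unseen≢r = proj₂ ∘ ∈-filter⁻ (λ w → ¬? (w ≟ r)) {xs = white}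

    unseen<white : length unseen < length white
    unseen<white = filter-notAll (λ w → ¬? (w ≟ r)) white (Any.map (λ r≡w w≢r → w≢r (sym r≡w)) r∈white)

    unseen≤fuel : length unseen ≤ fuel
    unseen≤fuel = s≤s⁻¹ (≤-trans unseen<white white≤fuel)

    S₁ : Search unseen (Adj r) (suc start) (suc base)
    S₁ = search fuel unseen unseen≤fuel (adj? r) (suc start) (suc base)
    module S₁ = Search S₁

    S₂ : Search S₁.rest Root (suc S₁.finish) base
    S₂ = search fuel S₁.rest (≤-trans S₁.rest-length unseen≤fuel) Root? (suc S₁.finish) base
    module S₂ = Search S₂

    e : Visit
    -- Leaving at the end of the inner search makes the interval of `r` contain all intervals below
    -- it.
    e = visit r start S₁.finish base

    start<mid : start < suc S₁.finish
    start<mid = m<n⇒m<1+n S₁.start≤finish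

    covers : ∀ {w} → w ∈ white → w ∈ S₂.rest ⊎ ∃[ f ] f ∈ e ∷ S₁.visits ++ S₂.visits × vertex f ≡ w
    covers {w} w∈white with w ≟ r
    ... | yes w≡r = inj₂ (e , here refl , sym w≡r)
    ... | no  w≢r with S₁.covers (∈-filter⁺ (λ w → ¬? (w ≟ r)) w∈white w≢r)
    ...   | inj₂ (f , f∈ , f≡w) = inj₂ (f , there (∈-++⁺ˡ f∈) , f≡w)
    ...   | inj₁ w∈rest₁ =
            Sum.map₂ (λ (f , f∈ , f≡w) → f , there (∈-++⁺ʳ S₁.visits f∈) , f≡w) (S₂.covers w∈rest₁)

    early : ∀ {f} → Within (suc start) S₁.finish (suc base) f → Within start S₂.finish base f
    early (within s el t l) = within (<⇒≤ s) el (<-trans t S₂.start≤finish) (<⇒≤ l)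

    late : ∀ {f} → Within (suc S₁.finish) S₂.finish base f → Within start S₂.finish base f
    late (within s el t l) = within (≤-trans (<⇒≤ start<mid) s) el t l

    root-first : ∀ {f} → vertex f ∈ unseen × Within (suc start) S₁.finish (suc base) f → InPreorder e f
    root-first (f∈ , within s _ t l) = in-preorder (≢-sym (unseen≢r f∈)) (inj₁ (s , <⇒≤ t , l))

    root-done : ∀ {f} → vertex f ∈ S₁.rest × Within (suc S₁.finish) S₂.finish base f → InPreorder e f
    root-done (f∈ , within s _ _ _) =
      in-preorder (≢-sym (unseen≢r (S₁.rest⊆white f∈))) (inj₂ (s , All.lookup S₁.no-root-left f∈))

    in-order : ∀ {f g} → All (λ w → vertex f ≢ w × ¬ Adj (vertex f) w) S₁.rest →
      Within (suc start) S₁.finish (suc base) f →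
      vertex g ∈ S₁.rest × Within (suc S₁.finish) S₂.finish base g → InPreorder f g
    in-order ex (within _ _ t _) (g∈ , within s _ _ _) =
      let f≢g , ¬fg = All.lookup ex g∈ in in-preorder f≢g (inj₂ (<-trans t s , ¬fg))

    parent₁ : ∀ {f} →
      Within (suc start) S₁.finish (suc base) f ×
      ((Adj r (vertex f) × level f ≡ suc base) ⊎ ∃[ p ] p ∈ S₁.visits × ChildOf f p) →
      (Root (vertex f) × level f ≡ base) ⊎ ∃[ p ] p ∈ e ∷ S₁.visits ++ S₂.visits × ChildOf f p
    parent₁ (within s _ t l , inj₁ (rf , eq)) = inj₂ (e , here refl , rf , (s , <⇒≤ t , l) , eq)
    parent₁ (_ , inj₂ (p , p∈ , child))        = inj₂ (p , there (∈-++⁺ˡ p∈) , child)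

  -- The search forest of the whole graph

  record SearchForest : Set where
    field
      at            : Fin n → Visit
      horizon       : ℕ
      enter≤leave   : ∀ v → enter (at v) ≤ leave (at v)
      leave≤horizon : ∀ v → leave (at v) ≤ horizon

    infix 4 _⊐_

    _⊐_ : Fin n → Fin n → Set
    u ⊐ v = Encloses (at u) (at v)

    Apart : Fin n → Fin n → Set
    Apart u v = leave (at u) < enter (at v) ⊎ leave (at v) < enter (at u)

    field
      compare : ∀ {u v} → u ≢ v → (u ⊐ v ⊎ v ⊐ u) ⊎ (Apart u v × ¬ Adj u v)
      parent  : ∀ v → level (at v) ≡ 0 ⊎ ∃[ p ] Adj p v × p ⊐ v × level (at v) ≡ suc (level (at p))

  search-forest : SearchForest
  search-forest = record
    { at            = at
    ; horizon       = S.finish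
    ; enter≤leave   = λ v → Within.enter≤leave (All.lookup S.timely (at∈ v))
    ; leave≤horizon = λ v → <⇒≤ (Within.leave<finish (All.lookup S.timely (at∈ v)))
    ; compare       = compare
    ; parent        = parent
    }
    where
    S : Search (allFin n) U 0 0
    S = search (length (allFin n)) (allFin n) ≤-refl U? 0 0
    module S = Search S

    visit-of : ∀ v → ∃[ e ] e ∈ S.visits × vertex e ≡ v
    visit-of v with S.covers (∈-allFin v)
    -- Every vertex is a root here, so none can be left over.
    ... | inj₁ v∈rest = contradiction _ (All.lookup S.no-root-left v∈rest)
    ... | inj₂ e      = e

    at : Fin n → Visit
    at v = proj₁ (visit-of v)

    at∈ : ∀ v → at v ∈ S.visits
    at∈ v = proj₁ (proj₂ (visit-of v))

    vertex-at : ∀ v → vertex (at v) ≡ v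
    vertex-at v = proj₂ (proj₂ (visit-of v))

    -- Distinct entries of the visit list carry distinct vertices, so each vertex has only one
    -- visit. This identifies a parent found in the list with the visit chosen for its vertex.
    at-vertex : ∀ {e} → e ∈ S.visits → at (vertex e) ≡ e
    at-vertex {e} e∈ with AllPairs-lookup S.preorder (at∈ (vertex e)) e∈
    ... | inj₁ eq        = eq
    ... | inj₂ (inj₁ ef) = contradiction (vertex-at (vertex e)) (InPreorder.distinct ef)
    ... | inj₂ (inj₂ fe) = contradiction (sym (vertex-at (vertex e))) (InPreorder.distinct fe)

    non-adjacent : ∀ {u v} → ¬ Adj (vertex (at u)) (vertex (at v)) → ¬ Adj u v
    non-adjacent {u} {v} = subst (¬_) (cong₂ Adj (vertex-at u) (vertex-at v))

    compare : ∀ {u v} → u ≢ v → (Encloses (at u) (at v) ⊎ Encloses (at v) (at u)) ⊎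
      ((leave (at u) < enter (at v) ⊎ leave (at v) < enter (at u)) × ¬ Adj u v)
    compare {u} {v} u≢v with AllPairs-lookup S.preorder (at∈ u) (at∈ v)
    ... | inj₁ eq = contradiction (trans (sym (vertex-at u)) (trans (cong vertex eq) (vertex-at v))) u≢v
    ... | inj₂ (inj₁ (in-preorder _ (inj₁ uv)))         = inj₁ (inj₁ uv)
    ... | inj₂ (inj₁ (in-preorder _ (inj₂ (u<v , ¬a)))) = inj₂ (inj₁ u<v , non-adjacent ¬a)
    ... | inj₂ (inj₂ (in-preorder _ (inj₁ vu)))         = inj₁ (inj₂ vu)
    ... | inj₂ (inj₂ (in-preorder _ (inj₂ (v<u , ¬a)))) = inj₂ (inj₂ v<u , non-adjacent ¬a ∘ Adj-sym)

    parent : ∀ v → level (at v) ≡ 0 ⊎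
      ∃[ p ] Adj p v × Encloses (at p) (at v) × level (at v) ≡ suc (level (at p))
    parent v with All.lookup S.parent (at∈ v)
    ... | inj₁ (_ , level≡0)                  = inj₁ level≡0
    ... | inj₂ (p , p∈ , adj , p⊐v , level≡) = inj₂
          ( vertex p
          , subst (Adj (vertex p)) (vertex-at v) adj
          , subst (λ q → Encloses q (at v)) (sym (at-vertex p∈)) p⊐v
          , subst (λ q → level (at v) ≡ suc (level q)) (sym (at-vertex p∈)) level≡ )

  open SearchForest search-forest

  depth : Fin n → ℕ
  depth v = level (at v)

  adjacent⇒comparable : ∀ {u v} → Adj u v → u ⊐ v ⊎ v ⊐ u
  adjacent⇒comparable uv with compare (λ u≡v → irrefl u≡v uv)
  ... | inj₁ comparable = comparable
  ... | inj₂ (_ , ¬uv)  = contradiction uv ¬uv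

  -- Both intervals contain the entering time of `w`, so they cannot be apart.
  ancestors-comparable : ∀ {u v w} → u ⊐ w → v ⊐ w → u ≢ v → u ⊐ v ⊎ v ⊐ u
  ancestors-comparable {w = w} (u<w , w≤u , _) (v<w , w≤v , _) u≢v with compare u≢v
  ... | inj₁ comparable       = comparable
  ... | inj₂ (inj₁ u<v , _) = contradiction (<-trans u<v v<w) (≤⇒≯ (≤-trans (enter≤leave w) w≤u))
  ... | inj₂ (inj₂ v<u , _) = contradiction (<-trans v<u u<w) (≤⇒≯ (≤-trans (enter≤leave w) w≤v))

  -- Cycles from long edges

  -- The tree path from `v` up to `u`, obtained by following parents. The last clause ties the index
  -- to the depth, from which the vertices of a cycle are later seen to be distinct.
  ascent : ∀ j {u v} → u ⊐ v ⊎ u ≡ v → j + depth u ≡ depth v →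
    Σ (Fin (suc j) → Fin n) λ f →
      f zero ≡ v × f (fromℕ j) ≡ u ×
      (∀ i → Adj (f (inject₁ i)) (f (suc i))) × (∀ i → toℕ i + depth (f i) ≡ depth v)
  ascent zero {u} {v} (inj₁ (_ , _ , u<v)) eq = contradiction eq (<⇒≢ u<v)
  ascent zero {u} (inj₂ refl) eq = (λ _ → u) , refl , refl , (λ ()) , λ { zero → refl }
  ascent (suc j) {u} (inj₂ refl) eq = contradiction (sym eq) (<⇒≢ (s≤s (m≤n+m (depth u) j)))
  ascent (suc j) {u} {v} (inj₁ u⊐v) eq with parent v
  ... | inj₁ v≡0 = contradiction (trans eq v≡0) λ ()
  ... | inj₂ (p , pv , p⊐v , v≡1+p) with ascent j u⊒p (suc-injective (trans eq v≡1+p))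
    where
    -- `p` is only one level above `v`, which leaves no level for `u` strictly between them.
    u⊒p : u ⊐ p ⊎ u ≡ p
    u⊒p with u ≟ p
    ... | yes u≡p = inj₂ u≡p
    ... | no  u≢p with ancestors-comparable u⊐v p⊐v u≢p
    ...   | inj₁ u⊐p = inj₁ u⊐p
    ...   | inj₂ (_ , _ , p<u) = contradiction (subst (depth u <_) v≡1+p (proj₂ (proj₂ u⊐v))) (≤⇒≯ p<u)
  ... | f , f₀≡p , fⱼ≡u , step , height = g , refl , fⱼ≡u , step′ , height′
    where
    g : Fin (suc (suc j)) → Fin n
    g zero    = v
    g (suc i) = f i

    step′ : ∀ i → Adj (g (inject₁ i)) (g (suc i))
    step′ zero    = subst (Adj v) (sym f₀≡p) (Adj-sym pv)
    step′ (suc i) = step i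

    height′ : ∀ i → toℕ i + depth (g i) ≡ depth v
    height′ zero    = refl
    height′ (suc i) = trans (cong suc (height i)) (sym v≡1+p)

  -- The edge closes the tree path from `v` to `u`. A span of `2 + j` levels gives a path with
  -- `3 + j` vertices, enough for a cycle.
  long-edge⇒cycle : ∀ {u v} → Adj u v → u ⊐ v → 2 + depth u ≤ depth v →
    Σ (SimpleCycle G) λ C → SimpleCycle.length C + depth u ≡ suc (depth v)
  long-edge⇒cycle {u} {v} uv u⊐v long with m≤n⇒∃[o]m+o≡n long
  ... | j , eq with ascent (2 + j) (inj₁ u⊐v) eq′
    where
    eq′ : 2 + j + depth u ≡ depth v
    eq′ = trans (cong (2 +_) (+-comm j (depth u))) eq
  ... | f , f₀≡v , fⱼ≡u , step , height = C , cong suc (trans (cong (2 +_) (+-comm j (depth u))) eq)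
    where
    C : SimpleCycle G
    C = record
      { pred-length = 2 + j
      ; 3≤length    = s≤s (s≤s (s≤s z≤n))
      ; vertex      = f
      ; distinct    = λ {x} {y} fx≡fy → toℕ-injective (+-cancelʳ-≡ (depth (f x)) (toℕ x) (toℕ y)
                        (trans (height x) (trans (sym (height y)) (cong (λ w → toℕ y + depth w) (sym fx≡fy)))))
      ; consecutive = step
      ; closing     = subst (λ w → Adj w (f zero)) (sym fⱼ≡u) (subst (Adj u) (sym f₀≡v) uv)
      }

  -- Box representations from short edges

  EdgesShorterThan : ℕ → Set
  EdgesShorterThan c = ∀ {u v} → Adj u v → u ⊐ v → depth v < c + depth u

  enclosing-intersect : ∀ {u v} → u ⊐ v ⊎ v ⊐ u → enter (at u) ≤ leave (at v)
  enclosing-intersect {v = v} (inj₁ (u<v , _)) = ≤-trans (<⇒≤ u<v) (enter≤leave v)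
  enclosing-intersect {u = u} (inj₂ (_ , u≤v , _)) = ≤-trans (enter≤leave u) u≤v

  forest-representation : EdgesShorterThan 2 → BoxRepresentation G 2
  forest-representation short = box-representation G lo hi lo≤hi adjacent non-adjacent
    where
    lo hi : Fin 2 → Fin n → ℕ
    lo zero       v = enter (at v)
    lo (suc zero) v = depth v
    hi zero       v = leave (at v)
    -- Unit intervals: consecutive levels touch, levels two apart do not.
    hi (suc zero) v = suc (depth v)

    lo≤hi : ∀ i v → lo i v ≤ hi i v
    lo≤hi zero       v = enter≤leave v
    lo≤hi (suc zero) v = n≤1+n (depth v)

    adjacent : ∀ i {u v} → Adj u v → lo i u ≤ hi i v
    adjacent zero       uv = enclosing-intersect (adjacent⇒comparable uv)
    adjacent (suc zero) uv with adjacent⇒comparable uv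
    ... | inj₁ (_ , _ , u<v) = m≤n⇒m≤1+n (<⇒≤ u<v)
    ... | inj₂ v⊐u           = s≤s⁻¹ (short (Adj-sym uv) v⊐u)

    -- The only ancestor one level above `v` is its parent, which is adjacent to `v`.
    deep : ∀ {u v} → u ⊐ v → ¬ Adj u v → suc (depth u) < depth v
    deep {u} {v} u⊐v ¬uv with parent v
    ... | inj₁ v≡0 = contradiction (subst (depth u <_) v≡0 (proj₂ (proj₂ u⊐v))) λ ()
    ... | inj₂ (p , pv , p⊐v , v≡1+p) with ancestors-comparable u⊐v p⊐v (λ { refl → ¬uv pv })
    ...   | inj₁ (_ , _ , u<p) = subst (suc (depth u) <_) (sym v≡1+p) (s≤s u<p)
    ...   | inj₂ (_ , _ , p<u) = contradiction (subst (depth u <_) v≡1+p (proj₂ (proj₂ u⊐v))) (≤⇒≯ p<u)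

    non-adjacent : ∀ {u v} → u ≢ v → ¬ Adj u v → ∃[ i ] (hi i u < lo i v ⊎ hi i v < lo i u)
    non-adjacent u≢v ¬uv with compare u≢v
    ... | inj₁ (inj₁ u⊐v)  = suc zero , inj₁ (deep u⊐v ¬uv)
    ... | inj₁ (inj₂ v⊐u)  = suc zero , inj₂ (deep v⊐u (¬uv ∘ Adj-sym))
    ... | inj₂ (apart , _) = zero , apart

  -- Levels coloured by their residue modulo `c`

  module _ (c : ℕ) .{{_ : NonZero c}} (short : EdgesShorterThan c) where

    colour : Fin n → Fin c
    colour v = depth v mod c

    colour-distance : ∀ {u v} → colour u ≡ colour v → u ⊐ v → c + depth u ≤ depth v
    colour-distance {u} {v} eq (_ , _ , u<v) =
      %-distance (trans (sym (toℕ-fromℕ< _)) (trans (cong toℕ eq) (toℕ-fromℕ< _))) u<v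

    UpNeighbour : Fin c → Fin n → Fin n → Set
    UpNeighbour i v u = colour u ≡ i × u ⊐ v × Adj u v

    up-neighbour? : ∀ i v → Dec (∃ (UpNeighbour i v))
    up-neighbour? i v = any? λ u → colour u ≟ i ×-dec encloses? (at u) (at v) ×-dec adj? u v

    -- Short edges make an adjacent ancestor of a given colour the deepest
    -- ancestor of that colour.
    up-neighbour-deepest : ∀ {i u v w} → UpNeighbour i v w → colour u ≡ i → u ⊐ v → u ≢ w → u ⊐ w
    up-neighbour-deepest (w≡i , w⊐v , wv) u≡i u⊐v u≢w with ancestors-comparable u⊐v w⊐v u≢w
    ... | inj₁ u⊐w = u⊐w
    ... | inj₂ w⊐u = contradiction
          (≤-trans (colour-distance (trans w≡i (sym u≡i)) w⊐u) (<⇒≤ (proj₂ (proj₂ u⊐v))))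
          (<⇒≱ (short wv w⊐v))

    -- In coordinate i the vertices of colour i are points; all others extend
    -- to the horizon, hence meet each other and all their descendants.
    lo hi : Fin c → Fin n → ℕ
    lo i v with up-neighbour? i v
    -- The interval reaches back just to the point of the adjacent ancestor of colour `i`;
    -- non-adjacent ancestors of that colour are entered earlier and stay to its left.
    ... | yes (u , _) = enter (at u)
    ... | no _        = enter (at v)
    hi i v with colour v ≟ i
    ... | yes _ = enter (at v)
    ... | no _  = horizon

    lo≤enter : ∀ i v → lo i v ≤ enter (at v)
    lo≤enter i v with up-neighbour? i v
    ... | yes (_ , _ , (u<v , _) , _) = <⇒≤ u<v
    ... | no _                        = ≤-refl

    enter≤horizon : ∀ v → enter (at v) ≤ horizon
    enter≤horizon v = ≤-trans (enter≤leave v) (leave≤horizon v)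

    enter≤hi : ∀ i v → enter (at v) ≤ hi i v
    enter≤hi i v with colour v ≟ i
    ... | yes _ = ≤-refl
    ... | no _  = enter≤horizon v

    lo-up-neighbour : ∀ {i u v} → UpNeighbour i v u → lo i v ≤ enter (at u)
    lo-up-neighbour {i} {u} {v} up with up-neighbour? i v
    ... | no ¬up = contradiction (u , up) ¬up
    ... | yes (w , w≡i , w⊐v , _) with w ≟ u
    ...   | yes refl = ≤-refl
    ...   | no  w≢u  = <⇒≤ (proj₁ (up-neighbour-deepest up w≡i w⊐v w≢u))

    -- If `v` has an up-neighbour of colour `i`, that one is the deepest ancestor of this colour, so
    -- `u` lies strictly above it; otherwise the interval starts at `v` itself.
    lo-non-adjacent : ∀ {i u v} → colour u ≡ i → u ⊐ v → ¬ Adj u v → enter (at u) < lo i v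
    lo-non-adjacent {i} {u} {v} u≡i u⊐v ¬uv with up-neighbour? i v
    ... | no _          = proj₁ u⊐v
    ... | yes (w , up) = proj₁ (up-neighbour-deepest up u≡i u⊐v λ { refl → ¬uv (proj₂ (proj₂ up)) })

    lo≤hi : ∀ i {u v} → Adj u v → lo i u ≤ hi i v
    lo≤hi i {u} {v} uv with colour v ≟ i
    ... | no _ = ≤-trans (lo≤enter i u) (enter≤horizon u)
    ... | yes v≡i with adjacent⇒comparable uv
    ...   | inj₁ (u<v , _) = ≤-trans (lo≤enter i u) (<⇒≤ u<v)
    -- Here `v` is an up-neighbour of `u`, and `lo` was extended to reach it.
    ...   | inj₂ v⊐u       = lo-up-neighbour (v≡i , v⊐u , Adj-sym uv)

    hi<lo : ∀ {u v} → u ⊐ v → ¬ Adj u v → hi (colour u) u < lo (colour u) v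
    hi<lo {u} u⊐v ¬uv with colour u ≟ colour u
    ... | yes _ = lo-non-adjacent refl u⊐v ¬uv
    ... | no ¬p = contradiction refl ¬p

    colour-representation : BoxRepresentation G (suc c)
    colour-representation = box-representation G lo′ hi′ lo′≤hi′ adjacent non-adjacent
      where
      lo′ hi′ : Fin (suc c) → Fin n → ℕ
      lo′ zero    v = enter (at v)
      lo′ (suc i) v = lo i v
      hi′ zero    v = leave (at v)
      hi′ (suc i) v = hi i v

      lo′≤hi′ : ∀ i v → lo′ i v ≤ hi′ i v
      lo′≤hi′ zero    v = enter≤leave v
      lo′≤hi′ (suc i) v = ≤-trans (lo≤enter i v) (enter≤hi i v)

      adjacent : ∀ i {u v} → Adj u v → lo′ i u ≤ hi′ i v
      adjacent zero    uv = enclosing-intersect (adjacent⇒comparable uv)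
      adjacent (suc i) uv = lo≤hi i uv

      non-adjacent : ∀ {u v} → u ≢ v → ¬ Adj u v → ∃[ i ] (hi′ i u < lo′ i v ⊎ hi′ i v < lo′ i u)
      non-adjacent {u} {v} u≢v ¬uv with compare u≢v
      -- The separating coordinate belongs to the colour of the ancestor, which is a point there.
      ... | inj₁ (inj₁ u⊐v)  = suc (colour u) , inj₁ (hi<lo u⊐v ¬uv)
      ... | inj₁ (inj₂ v⊐u)  = suc (colour v) , inj₂ (hi<lo v⊐u (¬uv ∘ Adj-sym))
      ... | inj₂ (apart , _) = zero , apart

  -- Long cycle or short edges, and the bound

  long-cycle-or-short-edges : ∀ c → 2 ≤ c →
    (Σ (SimpleCycle G) λ C → c < SimpleCycle.length C) ⊎ EdgesShorterThan c
  long-cycle-or-short-edges c 2≤c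
    with any? (λ u → any? (λ v → adj? u v ×-dec encloses? (at u) (at v) ×-dec c + depth u ≤? depth v))
  ... | no ¬long = inj₂ λ {u} {v} uv u⊐v → ≰⇒> λ long → ¬long (u , v , uv , u⊐v , long)
  ... | yes (u , v , uv , u⊐v , long) with long-edge⇒cycle uv u⊐v (≤-trans (+-monoˡ-≤ (depth u) 2≤c) long)
  -- The length is one more than the number of levels spanned, which is at least `c`.
  ...   | C , eq = inj₁ (C , +-cancelʳ-≤ (depth u) _ _ (≤-trans (s≤s long) (≤-reflexive (sym eq))))

theorem13 : ∀ {n} (G : Graph n) (b : ℕ) → 3 ≤ b → IsBoxicity G b →
    Σ (SimpleCycle G) λ C → b ∸ 3 ≤ SimpleCycle.length C
theorem13 G 0 () _
theorem13 G 1 (s≤s ()) _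
theorem13 G 2 (s≤s (s≤s ())) _
-- The length bound is trivial, but a cycle must exist. The coloured representation for `c = 2` has
-- dimension 3 and contradicts nothing, so the two-dimensional one is used.
theorem13 G 3 _ (_ , minimal) with long-cycle-or-short-edges G 2 ≤-refl
... | inj₁ (C , _) = C , z≤n
... | inj₂ short   = contradiction (minimal 2 (forest-representation G short)) (<⇒≱ ≤-refl)
-- The boxicity is `4 + b`, and `c = 2 + b` is the largest value for which the dimension `1 + c`
-- stays below it. The cycle has length at least `3 + b`, two more than required.
theorem13 G (suc (suc (suc (suc b)))) _ (_ , minimal) with long-cycle-or-short-edges G (2 + b) (s≤s (s≤s z≤n))
... | inj₁ (C , b<C) = C , ≤-trans (m≤n+m (suc b) 2) b<C
... | inj₂ short     =
      contradiction (minimal (3 + b) (colour-representation G (2 + b) short)) (<⇒≱ ≤-refl)
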